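{- For any binary string $s$ of length $1$ or $2$ other than $s=00$, there exist a strongly connected directed graph $D$, a parallel chip-firing game on $D$, and a vertex $v$ of $D$ such that $v$ has $s$ as its atomic firing sequence.
   Context: A directed graph $D=(V,E)$ is a finite set of vertices $V$ with a set $E$ of ordered pairs of vertices; $(u,v)\in E$ is an edge directed from $u$ to $v$, and the out-degree $\deg^+ v$ is the number of edges directed from $v$. It is strongly connected if there is a directed path in both directions between every pair of vertices. A parallel chip-firing game on $D$ starts with a finite nonnegative integer number of chips on each vertex. In each round, simultaneously, every vertex $v$ having at least $\deg^+ v$ chips fires, sending one chip along each of its outgoing edges; all other vertices wait. The game has period $T$ if $T$ is the smallest positive integer for which there is a round $t_0$ such that every vertex has the same number of chips in round $t$ as in round $t+T$ for all $t\ge t_0$. The least such $t_0$ is relabelled round $0$. Let $F_t(v)=1$ if $v$ fires in round $t$ and $F_t(v)=0$ otherwise. The atomic firing sequence of $v$ is the length-$T$ binary string $F_0(v)F_1(v)\cdots F_{T-1}(v)$, where $T$ is the period of the game. -}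

module Defs where

open import Data.Bool using (Bool; _∧_; if_then_else_)
open import Data.Fin using (Fin)
open import Data.Fin.Subset using (Subset; _∈_; ∣_∣)
open import Data.List using (List; applyUpTo)
open import Data.Nat using (ℕ; zero; suc; _+_; _∸_; _≤_; _<_; _≤ᵇ_)
open import Data.Product using (_×_; ∃-syntax)
open import Data.Vec using (lookup; tabulate)
open import Relation.Binary.Construct.Closure.ReflexiveTransitive using (Star)
open import Relation.Binary.PropositionalEquality using (_≡_)

-- The edge set is given by its rows: out u = { v ∣ (u , v) ∈ E }.
-- There are no multiple edges; loops (v , v) are not excluded.
record Digraph : Set where
  field
    order : ℕ
    out   : Fin order → Subset order

  Vertex : Set
  Vertex = Fin order

  Edge : Vertex → Vertex → Set
  Edge u v = v ∈ out u

  deg⁺ : Vertex → ℕ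
  deg⁺ v = ∣ out v ∣

  StronglyConnected : Set
  StronglyConnected = ∀ u v → Star Edge u v

module ChipFiring (D : Digraph) where
  open Digraph D

  Config : Set
  Config = Vertex → ℕ

  fires : Config → Vertex → Bool
  fires c v = deg⁺ v ≤ᵇ c v

  lost : Config → Vertex → ℕ
  lost c v = if fires c v then deg⁺ v else 0

  -- The number of firing vertices u with an edge (u , v).
  gained : Config → Vertex → ℕ
  gained c v = ∣ tabulate (λ u → fires c u ∧ lookup (out u) v) ∣

  -- The truncated subtraction never truncates: lost c v ≤ c v.
  step : Config → Config
  step c v = (c v ∸ lost c v) + gained c v

  -- The game started from c, after t rounds.
  chips : Config → ℕ → Config
  chips c zero    = c
  chips c (suc t) = step (chips c t)

  RepeatsFrom : Config → ℕ → ℕ → Set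
  RepeatsFrom c T t₀ = ∀ t → t₀ ≤ t → ∀ v → chips c t v ≡ chips c (t + T) v

  EventuallyRepeats : Config → ℕ → Set
  EventuallyRepeats c T = 0 < T × ∃[ t₀ ] RepeatsFrom c T t₀

  IsPeriod : Config → ℕ → Set
  IsPeriod c T = EventuallyRepeats c T × (∀ T′ → EventuallyRepeats c T′ → T ≤ T′)

  IsOnset : Config → ℕ → ℕ → Set
  IsOnset c T t₀ = RepeatsFrom c T t₀ × (∀ t₁ → RepeatsFrom c T t₁ → t₀ ≤ t₁)

  -- Bits are Booleans, with true for 1 (fires) and false for 0 (waits).
  -- Rounds are counted from the initial configuration, so the round
  -- relabelled 0 is t₀ here.
  AtomicFiringSequence : Config → Vertex → List Bool → Set
  AtomicFiringSequence c v s =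
    ∃[ T ] ∃[ t₀ ] IsPeriod c T × IsOnset c T t₀
      × s ≡ applyUpTo (λ i → fires (chips c (t₀ + i)) v) T

{-# OPTIONS --safe #-}
-- One game on the digraph a → b, b → a, b → d, d → a realises all three
-- strings of length 2.  A vertex that fires in every round of a game of
-- period 2 calls for a digraph that is not Eulerian: the numbers x of firings
-- per period satisfy deg⁺ v · x v = Σ x u over the edges (u , v), and here
-- x = (2 , 1 , 1) on a , b , d.
module Submission where

open import Defs
open import Data.Bool using (Bool; true; false; _∧_; if_then_else_)
open import Data.Fin using (zero; suc)
open import Data.Fin.Subset using (∣_∣)
open import Data.List using (List; []; _∷_; length)
open import Data.Nat using (zero; suc; _+_; _*_; _∸_; _≤ᵇ_; z≤n; s≤s)
open import Data.Nat.Properties using (+-comm; m≤m*n)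
open import Data.Product using (Σ-syntax; _×_; _,_)
open import Data.Sum using (_⊎_; inj₁; inj₂)
open import Data.Vec using ([]; _∷_; lookup; here; there)
open import Data.Vec.Properties using (tabulate-cong)
open import Relation.Binary.Construct.Closure.ReflexiveTransitive using (Star; ε; _◅_; _◅◅_)
open import Relation.Binary.PropositionalEquality
  using (_≡_; _≢_; _≗_; refl; sym; cong; cong₂; module ≡-Reasoning)
open import Relation.Nullary using (¬_; contradiction)

module _ (D : Digraph) where
  open Digraph D
  open ChipFiring D

  -- A hub replaces the check over pairs of vertices by two checks over single vertices.
  stronglyConnected-via : ∀ h → (∀ u → Star Edge u h) → (∀ v → Star Edge h v) →
                          StronglyConnected
  stronglyConnected-via h to from u v = to u ◅◅ from v

  -- Configurations are functions compared pointwise, so an equality has to be carried through a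
  -- round: the loss at `v` reads only `c v`, the gain reads `c u` at each possible sender `u`.
  step-cong : ∀ {c c′} → c ≗ c′ → step c ≗ step c′
  step-cong {c} {c′} c≗c′ v = cong₂ _+_
    (cong (λ n → n ∸ (if deg⁺ v ≤ᵇ n then deg⁺ v else 0)) (c≗c′ v))
    (cong ∣_∣ (tabulate-cong λ u →
      cong (λ n → (deg⁺ u ≤ᵇ n) ∧ lookup (out u) v) (c≗c′ u)))

  chips-periodic : ∀ {c T} → chips c T ≗ c → ∀ t → chips c (t + T) ≗ chips c t
  chips-periodic eq zero    = eq
  chips-periodic eq (suc t) = step-cong (chips-periodic eq t)

  chips-multiple : ∀ {c T} → chips c T ≗ c → ∀ k → chips c (k * T) ≗ c
  chips-multiple         eq zero    v = refl
  chips-multiple {c} {T} eq (suc k) v = begin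
    chips c (T + k * T) v  ≡⟨ cong (λ t → chips c t v) (+-comm T (k * T)) ⟩
    chips c (k * T + T) v  ≡⟨ chips-periodic eq (k * T) v ⟩
    chips c (k * T) v      ≡⟨ chips-multiple eq k v ⟩
    c v                    ∎
    where open ≡-Reasoning

  repeatsFrom-0 : ∀ {c T} → chips c T ≗ c → RepeatsFrom c T 0
  repeatsFrom-0 eq t _ v = sym (chips-periodic eq t v)

  -- A configuration that recurs has no transient, so the relabelled round 0 is the initial round.
  isOnset-0 : ∀ {c T} → chips c T ≗ c → IsOnset c T 0
  isOnset-0 eq = repeatsFrom-0 eq , λ _ _ → z≤n

  -- A period 1 holding from round t₀ on would hold in particular at round
  -- t₀ · 2, where the configuration is c again.
  ¬eventuallyRepeats-1 : ∀ {c} v → chips c 2 ≗ c → step c v ≢ c v → ¬ EventuallyRepeats c 1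
  ¬eventuallyRepeats-1 {c} v eq neq (_ , t₀ , repeats) = neq (begin
    step c v                   ≡⟨ step-cong (chips-multiple eq t₀) v ⟨
    chips c (1 + t₀ * 2) v     ≡⟨ cong (λ t → chips c t v) (+-comm 1 (t₀ * 2)) ⟩
    chips c (t₀ * 2 + 1) v     ≡⟨ repeats (t₀ * 2) (m≤m*n t₀ 2) v ⟨
    chips c (t₀ * 2) v         ≡⟨ chips-multiple eq t₀ v ⟩
    c v                        ∎)
    where open ≡-Reasoning

  isPeriod-1 : ∀ {c} → step c ≗ c → IsPeriod c 1
  isPeriod-1 eq = (s≤s z≤n , 0 , repeatsFrom-0 eq) , λ _ (0<T′ , _) → 0<T′

  isPeriod-2 : ∀ {c} v → chips c 2 ≗ c → step c v ≢ c v → IsPeriod c 2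
  isPeriod-2 {c} v eq neq = (s≤s z≤n , 0 , repeatsFrom-0 eq) , minimal
    where
    minimal : ∀ T′ → EventuallyRepeats c T′ → _
    minimal zero          (() , _)
    minimal (suc zero)    repeats = contradiction repeats (¬eventuallyRepeats-1 v eq neq)
    minimal (suc (suc _)) _       = s≤s (s≤s z≤n)

  atomicFiringSequence-1 : ∀ {c} → step c ≗ c → ∀ v →
    AtomicFiringSequence c v (fires c v ∷ [])
  -- With onset 0, `t₀ + i` computes to `i` and `applyUpTo` unfolds to the string.
  atomicFiringSequence-1 eq v = 1 , 0 , isPeriod-1 eq , isOnset-0 eq , refl

  -- `w` rules out period 1, while `v` is the vertex whose string is read. They are kept apart
  -- because a vertex with a constant number of chips also has a string.
  atomicFiringSequence-2 : ∀ {c} w → chips c 2 ≗ c → step c w ≢ c w → ∀ v →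
    AtomicFiringSequence c v (fires c v ∷ fires (step c) v ∷ [])
  atomicFiringSequence-2 w eq neq v = 2 , 0 , isPeriod-2 w eq neq , isOnset-0 eq , refl

-- In-degrees and out-degrees are all 1, so both the empty configuration (all wait) and one chip per
-- vertex (all fire) are fixed by `step`.
twoCycle : Digraph
twoCycle = record
  { order = 2
  ; out   = λ { zero       → false ∷ true  ∷ []
              ; (suc zero) → true  ∷ false ∷ [] }
  }

twoCycle-stronglyConnected : Digraph.StronglyConnected twoCycle
twoCycle-stronglyConnected = stronglyConnected-via twoCycle zero
  (λ { zero → ε ; (suc zero) → here ◅ ε })
  (λ { zero → ε ; (suc zero) → there here ◅ ε })

-- The rows belong to a, b, d in this order.
triangle : Digraph
triangle = record
  { order = 3
  ; out   = λ { zero             → false ∷ true  ∷ false ∷ []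
              ; (suc zero)       → true  ∷ false ∷ true  ∷ []
              ; (suc (suc zero)) → true  ∷ false ∷ false ∷ [] }
  }

triangle-stronglyConnected : Digraph.StronglyConnected triangle
triangle-stronglyConnected = stronglyConnected-via triangle zero
  (λ { zero → ε ; (suc zero) → here ◅ ε ; (suc (suc zero)) → here ◅ ε })
  (λ { zero             → ε
     ; (suc zero)       → there here ◅ ε
     -- The path a → b → d, with b as the intermediate vertex `j`.
     ; (suc (suc zero)) → _◅_ {j = suc zero} (there here) (there (there here) ◅ ε) })

-- The game alternates between (1 , 2 , 0), where a and b fire, and (1 , 1 , 1), where a and d fire.
-- Hence a, b, d have the strings 11, 10, 01.
triangleChips : ChipFiring.Config triangle
triangleChips zero             = 1
triangleChips (suc zero)       = 2
triangleChips (suc (suc zero)) = 0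

triangle-atomicFiringSequence : ∀ v → let open ChipFiring triangle in
  AtomicFiringSequence triangleChips v
    (fires triangleChips v ∷ fires (step triangleChips) v ∷ [])
-- The witness of change is b, which drops from 2 chips to 1; a holds 1 chip in both rounds.
triangle-atomicFiringSequence = atomicFiringSequence-2 triangle (suc zero)
  (λ { zero → refl ; (suc zero) → refl ; (suc (suc zero)) → refl })
  (λ ())

lemma4p2 : (s : List Bool) → length s ≡ 1 ⊎ length s ≡ 2 → s ≢ false ∷ false ∷ [] →
    Σ[ D ∈ Digraph ] Digraph.StronglyConnected D × (Σ[ c ∈ ChipFiring.Config D ] Σ[ v ∈ Digraph.Vertex D ] ChipFiring.AtomicFiringSequence D c v s)
lemma4p2 [] (inj₁ ()) _
lemma4p2 [] (inj₂ ()) _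
lemma4p2 (false ∷ []) _ _ = twoCycle , twoCycle-stronglyConnected , (λ _ → 0) , zero ,
  atomicFiringSequence-1 twoCycle (λ { zero → refl ; (suc zero) → refl }) zero
lemma4p2 (true ∷ []) _ _ = twoCycle , twoCycle-stronglyConnected , (λ _ → 1) , zero ,
  atomicFiringSequence-1 twoCycle (λ { zero → refl ; (suc zero) → refl }) zero
lemma4p2 (false ∷ false ∷ []) _ s≢00 = contradiction refl s≢00
lemma4p2 (false ∷ true ∷ []) _ _ = triangle , triangle-stronglyConnected , triangleChips ,
  suc (suc zero) , triangle-atomicFiringSequence (suc (suc zero))
lemma4p2 (true ∷ false ∷ []) _ _ = triangle , triangle-stronglyConnected , triangleChips ,
  suc zero , triangle-atomicFiringSequence (suc zero)
lemma4p2 (true ∷ true ∷ []) _ _ = triangle , triangle-stronglyConnected , triangleChips ,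
  zero , triangle-atomicFiringSequence zero
lemma4p2 (_ ∷ _ ∷ _ ∷ _) (inj₁ ()) _
lemma4p2 (_ ∷ _ ∷ _ ∷ _) (inj₂ ()) _
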